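{- Every modal rule system $\mathtt{M}\in \mathbf{NExt}(\mathtt{GL_R})$ is axiomatisable over $\mathtt{GL_R}$ by some set of modal pre-stable canonical rules of the form $\xi^+(\mathfrak{A}, D^{\square^+}, D^\square)$, where $\mathfrak{A}\in \mathsf{K4}$.
   Context: $\mathtt{GL}=\mathtt{K}\oplus\square(\square p\to p)\to\square p$; $\mathtt{GL_R}$ is the least modal rule system containing $/\varphi$ for $\varphi\in\mathtt{GL}$; $\mathsf{K4}$ is the class of transitive modal algebras. Write $\square^+\varphi:=\square\varphi\land\varphi$. For a finite modal algebra $\mathfrak{A}$ and $D^{\square^+},D^\square\subseteq A$, the modal pre-stable canonical rule $\xi^+(\mathfrak{A},D^{\square^+},D^\square)$ is $\Gamma/\Delta$ with fresh variables $p_a$ ($a\in A$), where $\Gamma=\{p_{a\land b}\leftrightarrow p_a\land p_b,\ p_{a\lor b}\leftrightarrow p_a\lor p_b:a,b\in A\}\cup\{p_{\neg a}\leftrightarrow\neg p_a:a\in A\}\cup\{p_{\square^+a}\to\square^+p_a:a\in A\}\cup\{\square^+p_a\to p_{\square^+a}:a\in D^{\square^+}\}\cup\{p_{\square a}\leftrightarrow\square p_a:a\in D^\square\}$ and $\Delta=\{p_a:a\in A\smallsetminus\{1\}\}$. -}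

module Defs where

open import Data.Nat using (ℕ)
open import Data.Bool using (Bool; true; false; _∧_; _∨_; not; if_then_else_)
open import Data.Fin using (Fin; toℕ; _≟_)
open import Data.Fin.Subset using (Subset)
open import Data.Fin.Subset.Properties using (_∈?_)
open import Data.List using (List; []; _∷_; [_]; _++_; map; filter; allFin; cartesianProductWith)
open import Data.List.Relation.Binary.Subset.Propositional using (_⊆_)
open import Data.Product using (Σ; ∃; _×_; _,_)
open import Data.Sum using (_⊎_)
open import Data.Empty using (⊥)
open import Relation.Nullary using (¬?)
open import Relation.Binary.PropositionalEquality using (_≡_)
open import Algebra.Lattice.Structures using (IsBooleanAlgebra)

infixr 4 _⇒_ _⇔ᶠ_
infixr 5 _⋁_
infixr 6 _⋀_
infix 7 ~_ □_ □⁺_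

data Fm : Set where
  var  : ℕ → Fm
  ⊥̇ ⊤̇ : Fm
  ~_   : Fm → Fm
  _⋀_  : Fm → Fm → Fm
  _⋁_  : Fm → Fm → Fm
  _⇒_  : Fm → Fm → Fm
  □_   : Fm → Fm

_⇔ᶠ_ : Fm → Fm → Fm
φ ⇔ᶠ ψ = (φ ⇒ ψ) ⋀ (ψ ⇒ φ)

□⁺_ : Fm → Fm
□⁺ φ = □ φ ⋀ φ

_⟪_⟫ : Fm → (ℕ → Fm) → Fm
var x ⟪ σ ⟫ = σ x
⊥̇ ⟪ σ ⟫ = ⊥̇
⊤̇ ⟪ σ ⟫ = ⊤̇
(~ φ) ⟪ σ ⟫ = ~ (φ ⟪ σ ⟫)
(φ ⋀ ψ) ⟪ σ ⟫ = (φ ⟪ σ ⟫) ⋀ (ψ ⟪ σ ⟫)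
(φ ⋁ ψ) ⟪ σ ⟫ = (φ ⟪ σ ⟫) ⋁ (ψ ⟪ σ ⟫)
(φ ⇒ ψ) ⟪ σ ⟫ = (φ ⟪ σ ⟫) ⇒ (ψ ⟪ σ ⟫)
(□ φ) ⟪ σ ⟫ = □ (φ ⟪ σ ⟫)

evalB : (Fm → Bool) → Fm → Bool
evalB v (var x) = v (var x)
evalB v ⊥̇ = false
evalB v ⊤̇ = true
evalB v (~ φ) = not (evalB v φ)
evalB v (φ ⋀ ψ) = evalB v φ ∧ evalB v ψ
evalB v (φ ⋁ ψ) = evalB v φ ∨ evalB v ψ
evalB v (φ ⇒ ψ) = not (evalB v φ) ∨ evalB v ψ
evalB v (□ φ) = v (□ φ)

Taut : Fm → Set
Taut φ = ∀ (v : Fm → Bool) → evalB v φ ≡ true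

-- Normal modal logics K ⊕ Ax (Ax given as a schema, hence substitution-closed)

data Thm (Ax : Fm → Set) : Fm → Set where
  ax   : ∀ {φ} → Ax φ → Thm Ax φ
  taut : ∀ {φ} → Taut φ → Thm Ax φ
  axK  : ∀ φ ψ → Thm Ax (□ (φ ⇒ ψ) ⇒ (□ φ ⇒ □ ψ))
  mp   : ∀ {φ ψ} → Thm Ax φ → Thm Ax (φ ⇒ ψ) → Thm Ax ψ
  nec  : ∀ {φ} → Thm Ax φ → Thm Ax (□ φ)

NoAx : Fm → Set
NoAx _ = ⊥

K : Fm → Set
K = Thm NoAx

LöbAx : Fm → Set
LöbAx χ = ∃ λ φ → χ ≡ (□ (□ φ ⇒ φ) ⇒ □ φ)

GL : Fm → Set
GL = Thm LöbAx

record Rule : Set where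
  constructor _/_
  field
    prem : List Fm
    conc : List Fm

substR : (ℕ → Fm) → Rule → Rule
substR σ (Γ / Δ) = map (_⟪ σ ⟫) Γ / map (_⟪ σ ⟫) Δ

record IsModalRuleSystem (M : Rule → Set) : Set where
  field
    reflexivity : ∀ φ → M ([ φ ] / [ φ ])
    weakening   : ∀ {Γ Δ Γ' Δ'} → M (Γ / Δ) → Γ ⊆ Γ' → Δ ⊆ Δ' → M (Γ' / Δ')
    cut         : ∀ {Γ Δ} φ → M (Γ / (φ ∷ Δ)) → M ((φ ∷ Γ) / Δ) → M (Γ / Δ)
    structural  : ∀ {r} (σ : ℕ → Fm) → M r → M (substR σ r)
    modusPonens : ∀ φ ψ → M ((φ ∷ (φ ⇒ ψ) ∷ []) / [ ψ ])
    necessitation : ∀ φ → M ([ φ ] / [ □ φ ])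
    containsK   : ∀ {φ} → K φ → M ([] / [ φ ])

data Derivable (B : Rule → Set) : Rule → Set where
  base        : ∀ {r} → B r → Derivable B r
  reflexivity : ∀ φ → Derivable B ([ φ ] / [ φ ])
  weakening   : ∀ {Γ Δ Γ' Δ'} → Derivable B (Γ / Δ) → Γ ⊆ Γ' → Δ ⊆ Δ' → Derivable B (Γ' / Δ')
  cut         : ∀ {Γ Δ} φ → Derivable B (Γ / (φ ∷ Δ)) → Derivable B ((φ ∷ Γ) / Δ) → Derivable B (Γ / Δ)
  structural  : ∀ {r} (σ : ℕ → Fm) → Derivable B r → Derivable B (substR σ r)
  modusPonens : ∀ φ ψ → Derivable B ((φ ∷ (φ ⇒ ψ) ∷ []) / [ ψ ])
  necessitation : ∀ φ → Derivable B ([ φ ] / [ □ φ ])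
  containsK   : ∀ {φ} → K φ → Derivable B ([] / [ φ ])

GLAxRules : Rule → Set
GLAxRules r = ∃ λ φ → GL φ × (r ≡ ([] / [ φ ]))

GLR : Rule → Set
GLR = Derivable GLAxRules

GLR⊕ : (Rule → Set) → Rule → Set
GLR⊕ Ξ = Derivable (λ r → GLAxRules r ⊎ Ξ r)

InNExtGLR : (Rule → Set) → Set
InNExtGLR M = IsModalRuleSystem M × (∀ r → GLR r → M r)

record FinModalAlgebra (n : ℕ) : Set where
  field
    _∧ᴬ_ _∨ᴬ_ : Fin n → Fin n → Fin n
    ¬ᴬ_ □ᴬ_   : Fin n → Fin n
    0ᴬ 1ᴬ     : Fin n
    isBooleanAlgebra : IsBooleanAlgebra _≡_ _∨ᴬ_ _∧ᴬ_ ¬ᴬ_ 1ᴬ 0ᴬ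
    □-1       : □ᴬ 1ᴬ ≡ 1ᴬ
    □-∧       : ∀ a b → □ᴬ (a ∧ᴬ b) ≡ (□ᴬ a) ∧ᴬ (□ᴬ b)

  □⁺ᴬ_ : Fin n → Fin n
  □⁺ᴬ a = (□ᴬ a) ∧ᴬ a

IsK4 : ∀ {n} → FinModalAlgebra n → Set
IsK4 {n} 𝔄 = ∀ (a : Fin n) → (□ᴬ a) ∧ᴬ (□ᴬ (□ᴬ a)) ≡ □ᴬ a
  where open FinModalAlgebra 𝔄

ξ⁺ : ∀ {n} → FinModalAlgebra n → Subset n → Subset n → Rule
ξ⁺ {n} 𝔄 D□⁺ D□ = Γ / Δ
  where
  open FinModalAlgebra 𝔄
  A : List (Fin n)
  A = allFin n
  p : Fin n → Fm
  p a = var (toℕ a)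
  Γ : List Fm
  Γ = cartesianProductWith (λ a b → p (a ∧ᴬ b) ⇔ᶠ (p a ⋀ p b)) A A
   ++ cartesianProductWith (λ a b → p (a ∨ᴬ b) ⇔ᶠ (p a ⋁ p b)) A A
   ++ map (λ a → p (¬ᴬ a) ⇔ᶠ (~ p a)) A
   ++ map (λ a → p (□⁺ᴬ a) ⇒ (□⁺ p a)) A
   ++ map (λ a → (□⁺ p a) ⇒ p (□⁺ᴬ a)) (filter (_∈? D□⁺) A)
   ++ map (λ a → p (□ᴬ a) ⇔ᶠ (□ p a)) (filter (_∈? D□) A)
  Δ : List Fm
  Δ = map p (filter (λ a → ¬? (a ≟ 1ᴬ)) A)

OnlyPreStableK4 : (Rule → Set) → Set
OnlyPreStableK4 Ξ = ∀ r → Ξ r →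
  Σ ℕ λ n → Σ (FinModalAlgebra n) λ 𝔄 → IsK4 𝔄 ×
    Σ (Subset n) λ D□⁺ → Σ (Subset n) λ D□ → r ≡ ξ⁺ 𝔄 D□⁺ D□

{-# OPTIONS --safe #-}

-- Filtration, carried out with cuts instead of points of a dual space.  Let θ collect the formulas of
-- a rule Γ / Δ of M, and call a valuation of its atoms (variables and boxed subformulas) a state, with
-- state description χ s.  Cutting on all formulas ¬χ s splits Γ / Δ into finitely many rules, each of
-- which declares the states of some set S possible and all others impossible.  Put s R t iff every
-- boxed subformula □φ that is true at s has both φ and □φ true at t.  This R is transitive, and because
-- GL proves □φ → □(□φ ∧ φ), the description of s implies boxed disjunctions of R-successor
-- descriptions; this is all that the stability premises of a pre-stable canonical rule demand.
-- If some possible state turns out impossible (it falsifies a formula of Γ, or it falsifies □φ while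
-- φ holds at all its R-successors), or some formula of Δ holds at all states of S, the split rule is
-- derivable outright.  Otherwise the complex algebra of (S , R) is a finite K4-algebra refuting Γ / Δ,
-- so M contains its rule ξ⁺ (with D□⁺ = ∅ and D□ the values of the boxed subformulas), and interpreting
-- p_U as the disjunction of the descriptions in U turns ξ⁺ into the split rule.
module Submission where

open import Defs
open import Algebra.Lattice.Structures using (IsBooleanAlgebra)
import Algebra.Lattice.Morphism.LatticeMonomorphism as LatticeMonomorphism
open import Data.Bool as Bool using (Bool; true; false; T; not; _∧_; _∨_; if_then_else_)
open import Data.Bool.Properties using (T-∧; T-∨; T-≡)
open import Data.Empty using (⊥-elim)
open import Data.Fin using (Fin; zero; suc; toℕ; _≟_; fromℕ<; combine; remQuot)
open import Data.Fin.Properties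
  using (all?; toℕ<n; fromℕ<-toℕ; ¬∀⟶∃¬; 2↔Bool; remQuot-combine; combine-remQuot)
open import Data.Fin.Subset as Subset using (Subset; _∈_; _∩_; _∪_; ∁)
open import Data.Fin.Subset.Properties
  using (_∈?_; ∪-∩-isBooleanAlgebra; ⊆-antisym; ∈⊤; ∉⊥; x∈p∩q⁺; x∈p∩q⁻; x∈p∪q⁺; x∈p∪q⁻; x∈∁p⇒x∉p; x∉p⇒x∈∁p)
open import Data.List
  using (List; []; _∷_; [_]; _++_; map; foldr; allFin; filter; length; lookup; cartesianProductWith)
open import Data.List.Membership.Propositional using (find; lose) renaming (_∈_ to _∈ₗ_)
open import Data.List.Membership.Propositional.Properties
  using ( ∈-++⁺ˡ; ∈-++⁺ʳ; ∈-map⁺; ∈-filter⁺; ∈-filter⁻; ∈-allFin; ∈-lookup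
        ; ∈-cartesianProductWith⁺; ∈-cartesianProductWith⁻)
open import Data.List.Relation.Binary.Permutation.Propositional using (↭-sym)
open import Data.List.Relation.Binary.Permutation.Propositional.Properties using (∈-resp-↭; shift)
open import Data.List.Relation.Binary.Subset.Propositional using (_⊆_)
open import Data.List.Relation.Binary.Subset.Propositional.Properties using (∷⁺ʳ; xs⊆xs++ys; xs⊆ys++xs)
open import Data.List.Relation.Unary.All as All using (All; []; _∷_)
import Data.List.Relation.Unary.All.Properties as All
open import Data.List.Relation.Unary.AllPairs using (AllPairs; []; _∷_)
open import Data.List.Relation.Unary.Any as Any using (Any; here; there)
import Data.List.Relation.Unary.Any.Properties as Any
open import Data.Nat as ℕ using (ℕ; zero; suc)
open import Data.Nat.Properties using (≡ᵇ⇒≡; ≡⇒≡ᵇ)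
open import Data.Product using (Σ; ∃; _×_; _,_; proj₁; proj₂)
open import Data.Sum as Sum using (_⊎_; inj₁; inj₂)
open import Data.Unit as Unit using (tt)
open import Data.Vec using ([]; _∷_; tabulate)
open import Data.Vec.Properties using (lookup⇒[]=; []=⇒lookup; lookup∘tabulate)
open import Function.Base using (_∘_; id; const)
open import Function.Bundles using (Equivalence; Inverse; _⇔_; mk⇔)
open import Level using (0ℓ)
open import Relation.Binary.Core using (Rel)
open import Relation.Binary.Definitions using (Decidable; Transitive)
open import Relation.Binary.PropositionalEquality
  using (_≡_; _≢_; refl; sym; trans; cong; cong₂; subst; module ≡-Reasoning)
open import Relation.Nullary using (¬_; Dec; yes; no; does; ¬?; contradiction; _→-dec_; _×-dec_)
open import Relation.Nullary.Decidable using (map′; dec-true)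
import Relation.Unary as Unary

-- Complex algebras of finite frames

comprehension : ∀ {m} {P : Fin m → Set} → Unary.Decidable P → Subset m
comprehension P? = tabulate (does ∘ P?)

module _ {m : ℕ} {P : Fin m → Set} (P? : Unary.Decidable P) where

  ∈-comprehension⁺ : ∀ {i} → P i → i ∈ comprehension P?
  ∈-comprehension⁺ {i} p = lookup⇒[]= i _ (trans (lookup∘tabulate _ i) (dec-true (P? i) p))

  ∈-comprehension⁻ : ∀ {i} → i ∈ comprehension P? → P i
  ∈-comprehension⁻ {i} i∈ with P? i | trans (sym (lookup∘tabulate (does ∘ P?) i)) ([]=⇒lookup i∈)
  ... | yes p | _ = p

-- The carrier of a `FinModalAlgebra` is some `Fin n` with propositional equality, so the powerset
-- algebra has to be transported to numbers along a bijection.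
encode : ∀ {m} → Subset m → Fin (2 ℕ.^ m)
encode []      = zero
encode (b ∷ U) = combine (Inverse.from 2↔Bool b) (encode U)

decode : ∀ {m} → Fin (2 ℕ.^ m) → Subset m
decode {zero}  _ = []
decode {suc m} a = Inverse.to 2↔Bool (proj₁ x,y) ∷ decode (proj₂ x,y)
  where
  x,y : Fin 2 × Fin (2 ℕ.^ m)
  x,y = remQuot (2 ℕ.^ m) a

decode-encode : ∀ {m} (U : Subset m) → decode (encode U) ≡ U
decode-encode [] = refl
decode-encode {suc m} (b ∷ U) = cong₂ _∷_
  (trans (cong (Inverse.to 2↔Bool ∘ proj₁) remQuot≡) (Inverse.strictlyInverseˡ 2↔Bool b))
  (trans (cong (decode ∘ proj₂) remQuot≡) (decode-encode U))
  where
  remQuot≡ : remQuot (2 ℕ.^ m) (encode (b ∷ U)) ≡ (Inverse.from 2↔Bool b , encode U)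
  remQuot≡ = remQuot-combine (Inverse.from 2↔Bool b) (encode U)

encode-decode : ∀ {m} (a : Fin (2 ℕ.^ m)) → encode (decode {m} a) ≡ a
encode-decode {zero} zero = refl
encode-decode {suc m} a = trans
  (cong₂ combine (Inverse.strictlyInverseʳ 2↔Bool (proj₁ x,y)) (encode-decode {m} (proj₂ x,y)))
  (combine-remQuot {2} (2 ℕ.^ m) a)
  where
  x,y : Fin 2 × Fin (2 ℕ.^ m)
  x,y = remQuot (2 ℕ.^ m) a

decode-injective : ∀ {m} {a b : Fin (2 ℕ.^ m)} → decode {m} a ≡ decode b → a ≡ b
decode-injective {m} {a} {b} eq = begin
  a                      ≡⟨ encode-decode {m} a ⟨
  encode (decode {m} a)  ≡⟨ cong encode eq ⟩
  encode (decode {m} b)  ≡⟨ encode-decode {m} b ⟩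
  b                      ∎
  where open ≡-Reasoning

module Complex {m : ℕ} {R : Rel (Fin m) 0ℓ} (R? : Decidable R) where

  successors⊆? : ∀ U i → Dec (∀ j → R i j → j ∈ U)
  successors⊆? U i = all? λ j → R? i j →-dec (j ∈? U)

  ⊡ : Subset m → Subset m
  ⊡ U = comprehension (successors⊆? U)

  ∈-⊡⁺ : ∀ {U i} → (∀ j → R i j → j ∈ U) → i ∈ ⊡ U
  ∈-⊡⁺ {U} = ∈-comprehension⁺ (successors⊆? U)

  ∈-⊡⁻ : ∀ {U i} → i ∈ ⊡ U → ∀ j → R i j → j ∈ U
  ∈-⊡⁻ {U} = ∈-comprehension⁻ (successors⊆? U)

  ⊡-∩ : ∀ U W → ⊡ (U ∩ W) ≡ ⊡ U ∩ ⊡ W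
  ⊡-∩ U W = ⊆-antisym
    (λ i∈ → x∈p∩q⁺ ( ∈-⊡⁺ (λ j r → proj₁ (x∈p∩q⁻ U W (∈-⊡⁻ i∈ j r)))
                   , ∈-⊡⁺ (λ j r → proj₂ (x∈p∩q⁻ U W (∈-⊡⁻ i∈ j r)))))
    (λ i∈ → let i∈U , i∈W = x∈p∩q⁻ (⊡ U) (⊡ W) i∈
            in ∈-⊡⁺ (λ j r → x∈p∩q⁺ (∈-⊡⁻ i∈U j r , ∈-⊡⁻ i∈W j r)))

  ⊡-transitive : Transitive R → ∀ U → ⊡ U ∩ ⊡ (⊡ U) ≡ ⊡ U
  ⊡-transitive R-trans U = ⊆-antisym
    (proj₁ ∘ x∈p∩q⁻ (⊡ U) _)
    (λ i∈ → x∈p∩q⁺ (i∈ , ∈-⊡⁺ λ j r → ∈-⊡⁺ λ k r′ → ∈-⊡⁻ i∈ k (R-trans r r′)))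

  private
    A : Set
    A = Fin (2 ℕ.^ m)

    _⊓_ _⊔_ : A → A → A
    a ⊓ b = encode (decode {m} a ∩ decode {m} b)
    a ⊔ b = encode (decode {m} a ∪ decode b)

    -_ □₁_ : A → A
    - a = encode (∁ (decode {m} a))
    □₁ a = encode (⊡ (decode a))

    open IsBooleanAlgebra (∪-∩-isBooleanAlgebra m)
      using (isDistributiveLattice; ∨-complementˡ; ∨-complementʳ; ∧-complementˡ; ∧-complementʳ)

    isBooleanAlgebra : IsBooleanAlgebra _≡_ _⊔_ _⊓_ -_ (encode {m} Subset.⊤) (encode {m} Subset.⊥)
    isBooleanAlgebra = record
      -- The lattice laws are pulled back from subsets along the injective homomorphism `decode`;
      -- the complement laws are transported by hand.
      { isDistributiveLattice = LatticeMonomorphism.isDistributiveLattice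
          {L₁ = record { _≈_ = _≡_ ; _∧_ = _⊓_ ; _∨_ = _⊔_ }}
          {L₂ = record { _≈_ = _≡_ ; _∧_ = _∩_ ; _∨_ = _∪_ }}
          {decode}
          (record
            { isLatticeHomomorphism = record
              { isRelHomomorphism = record { cong = cong decode }
              ; ∧-homo = λ _ _ → decode-encode _
              ; ∨-homo = λ _ _ → decode-encode _
              }
            ; injective = decode-injective
            })
          isDistributiveLattice
      ; ∨-complement =
          (λ a → cong encode (trans (cong (_∪ decode a) (decode-encode (∁ (decode a)))) (∨-complementˡ (decode a))))
        , (λ a → cong encode (trans (cong (decode a ∪_) (decode-encode (∁ (decode a)))) (∨-complementʳ (decode a))))
      ; ∧-complement =
          (λ a → cong encode (trans (cong (_∩ decode a) (decode-encode (∁ (decode a)))) (∧-complementˡ (decode a))))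
        , (λ a → cong encode (trans (cong (decode a ∩_) (decode-encode (∁ (decode a)))) (∧-complementʳ (decode a))))
      ; ¬-cong = cong -_
      }

  algebra : FinModalAlgebra (2 ℕ.^ m)
  algebra = record
    { _∧ᴬ_ = _⊓_
    ; _∨ᴬ_ = _⊔_
    ; ¬ᴬ_  = -_
    ; □ᴬ_  = □₁_
    ; 0ᴬ   = encode {m} Subset.⊥
    ; 1ᴬ   = encode {m} Subset.⊤
    ; isBooleanAlgebra = isBooleanAlgebra
    ; □-1  = cong encode (⊆-antisym (λ _ → ∈⊤) (λ _ → ∈-⊡⁺ λ j _ → subst (j ∈_) (sym (decode-encode Subset.⊤)) ∈⊤))
    ; □-∧  = λ a b → cong encode (begin
        ⊡ (decode (a ⊓ b))             ≡⟨ cong ⊡ (decode-encode _) ⟩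
        ⊡ (decode a ∩ decode b)        ≡⟨ ⊡-∩ (decode a) (decode b) ⟩
        ⊡ (decode a) ∩ ⊡ (decode b)    ≡⟨ cong₂ _∩_ (decode-encode _) (decode-encode _) ⟨
        decode (□₁ a) ∩ decode (□₁ b)  ∎)
    }
    where open ≡-Reasoning

  algebra-K4 : Transitive R → IsK4 algebra
  algebra-K4 R-trans a = cong encode (begin
    decode (□₁ a) ∩ decode (□₁ (□₁ a))  ≡⟨ cong₂ _∩_ (decode-encode _) (decode-encode _) ⟩
    ⊡ (decode a) ∩ ⊡ (decode (□₁ a))    ≡⟨ cong (λ U → ⊡ (decode a) ∩ ⊡ U) (decode-encode _) ⟩
    ⊡ (decode a) ∩ ⊡ (⊡ (decode a))     ≡⟨ ⊡-transitive R-trans (decode a) ⟩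
    ⊡ (decode a)                        ∎)
    where open ≡-Reasoning

-- Boolean equality of formulas

eqᶠ : Fm → Fm → Bool
eqᶠ (var x) (var y) = x ℕ.≡ᵇ y
eqᶠ ⊥̇ ⊥̇ = true
eqᶠ ⊤̇ ⊤̇ = true
eqᶠ (~ φ) (~ ψ) = eqᶠ φ ψ
eqᶠ (φ ⋀ φ′) (ψ ⋀ ψ′) = eqᶠ φ ψ ∧ eqᶠ φ′ ψ′
eqᶠ (φ ⋁ φ′) (ψ ⋁ ψ′) = eqᶠ φ ψ ∧ eqᶠ φ′ ψ′
eqᶠ (φ ⇒ φ′) (ψ ⇒ ψ′) = eqᶠ φ ψ ∧ eqᶠ φ′ ψ′
eqᶠ (□ φ) (□ ψ) = eqᶠ φ ψ
eqᶠ _ _ = false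

eqᶠ-sound : ∀ φ ψ → T (eqᶠ φ ψ) → φ ≡ ψ
eqᶠ-sound (var x) (var y) e = cong var (≡ᵇ⇒≡ x y e)
eqᶠ-sound ⊥̇ ⊥̇ e = refl
eqᶠ-sound ⊤̇ ⊤̇ e = refl
eqᶠ-sound (~ φ) (~ ψ) e = cong ~_ (eqᶠ-sound φ ψ e)
eqᶠ-sound (φ ⋀ φ′) (ψ ⋀ ψ′) e =
  let e₁ , e₂ = Equivalence.to T-∧ e in cong₂ _⋀_ (eqᶠ-sound φ ψ e₁) (eqᶠ-sound φ′ ψ′ e₂)
eqᶠ-sound (φ ⋁ φ′) (ψ ⋁ ψ′) e =
  let e₁ , e₂ = Equivalence.to T-∧ e in cong₂ _⋁_ (eqᶠ-sound φ ψ e₁) (eqᶠ-sound φ′ ψ′ e₂)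
eqᶠ-sound (φ ⇒ φ′) (ψ ⇒ ψ′) e =
  let e₁ , e₂ = Equivalence.to T-∧ e in cong₂ _⇒_ (eqᶠ-sound φ ψ e₁) (eqᶠ-sound φ′ ψ′ e₂)
eqᶠ-sound (□ φ) (□ ψ) e = cong □_ (eqᶠ-sound φ ψ e)

eqᶠ-refl : ∀ φ → T (eqᶠ φ φ)
eqᶠ-refl (var x) = ≡⇒≡ᵇ x x refl
eqᶠ-refl ⊥̇ = tt
eqᶠ-refl ⊤̇ = tt
eqᶠ-refl (~ φ) = eqᶠ-refl φ
eqᶠ-refl (φ ⋀ ψ) = Equivalence.from T-∧ (eqᶠ-refl φ , eqᶠ-refl ψ)
eqᶠ-refl (φ ⋁ ψ) = Equivalence.from T-∧ (eqᶠ-refl φ , eqᶠ-refl ψ)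
eqᶠ-refl (φ ⇒ ψ) = Equivalence.from T-∧ (eqᶠ-refl φ , eqᶠ-refl ψ)
eqᶠ-refl (□ φ) = eqᶠ-refl φ

-- Propositional semantics and derivations

Val : Set
Val = Fm → Bool

infix 3 _⊨_
-- The record wrapper keeps `v` and `φ` recoverable by unification; the bare type `T (evalB v φ)`
-- would compute and lose them.
record _⊨_ (v : Val) (φ : Fm) : Set where
  constructor ⟨_⟩
  field holds : T (evalB v φ)
open _⊨_

_⊨?_ : ∀ v φ → Dec (v ⊨ φ)
v ⊨? φ = map′ ⟨_⟩ holds (Bool.T? (evalB v φ))

module _ {v : Val} {φ ψ : Fm} where

  ⋀⁺ : v ⊨ φ → v ⊨ ψ → v ⊨ φ ⋀ ψ
  ⋀⁺ p q = ⟨ Equivalence.from T-∧ (holds p , holds q) ⟩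

  ⋀⁻ : v ⊨ φ ⋀ ψ → v ⊨ φ × v ⊨ ψ
  ⋀⁻ p = let q , r = Equivalence.to T-∧ (holds p) in ⟨ q ⟩ , ⟨ r ⟩

  ⋁⁺ : v ⊨ φ ⊎ v ⊨ ψ → v ⊨ φ ⋁ ψ
  ⋁⁺ (inj₁ p) = ⟨ Equivalence.from T-∨ (inj₁ (holds p)) ⟩
  ⋁⁺ (inj₂ p) = ⟨ Equivalence.from T-∨ (inj₂ (holds p)) ⟩

  ⋁⁻ : v ⊨ φ ⋁ ψ → v ⊨ φ ⊎ v ⊨ ψ
  ⋁⁻ p with Equivalence.to T-∨ (holds p)
  ... | inj₁ q = inj₁ ⟨ q ⟩
  ... | inj₂ q = inj₂ ⟨ q ⟩

  ⇒⁺ : (v ⊨ φ → v ⊨ ψ) → v ⊨ φ ⇒ ψ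
  ⇒⁺ f with evalB v φ in eq
  ... | true  = ⟨ subst (λ b → T (not b ∨ evalB v ψ)) (sym eq) (holds (f ⟨ subst T (sym eq) tt ⟩)) ⟩
  ... | false = ⟨ subst (λ b → T (not b ∨ evalB v ψ)) (sym eq) tt ⟩

  ⇒⁻ : v ⊨ φ ⇒ ψ → v ⊨ φ → v ⊨ ψ
  ⇒⁻ p q = ⟨ subst (λ b → T (not b ∨ evalB v ψ)) (Equivalence.to T-≡ (holds q)) (holds p) ⟩

module _ {v : Val} {φ : Fm} where

  ~⁺ : ¬ (v ⊨ φ) → v ⊨ ~ φ
  ~⁺ f with evalB v φ in eq
  ... | true  = ⊥-elim (f ⟨ subst T (sym eq) tt ⟩)
  ... | false = ⟨ subst (T ∘ not) (sym eq) tt ⟩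

  ~⁻ : v ⊨ ~ φ → ¬ (v ⊨ φ)
  ~⁻ p q = subst (T ∘ not) (Equivalence.to T-≡ (holds q)) (holds p)

module _ {v : Val} {φ ψ : Fm} where

  ⇔⁺ : (v ⊨ φ → v ⊨ ψ) → (v ⊨ ψ → v ⊨ φ) → v ⊨ (φ ⇔ᶠ ψ)
  ⇔⁺ f g = ⋀⁺ (⇒⁺ f) (⇒⁺ g)

  ⇔⁻¹ : v ⊨ (φ ⇔ᶠ ψ) → v ⊨ φ → v ⊨ ψ
  ⇔⁻¹ = ⇒⁻ ∘ proj₁ ∘ ⋀⁻

  ⇔⁻² : v ⊨ (φ ⇔ᶠ ψ) → v ⊨ ψ → v ⊨ φ
  ⇔⁻² = ⇒⁻ ∘ proj₂ ∘ ⋀⁻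

infixr 4 _⇛_
_⇛_ : List Fm → Fm → Fm
φs ⇛ ψ = foldr _⇒_ ψ φs

⇛⁺ : ∀ {v ψ} φs → (All (v ⊨_) φs → v ⊨ ψ) → v ⊨ φs ⇛ ψ
⇛⁺ []       f = f []
⇛⁺ (φ ∷ φs) f = ⇒⁺ λ p → ⇛⁺ φs (f ∘ (p ∷_))

⇛⁻ : ∀ {v ψ} φs → v ⊨ φs ⇛ ψ → All (v ⊨_) φs → v ⊨ ψ
⇛⁻ []       p []       = p
⇛⁻ (φ ∷ φs) p (q ∷ qs) = ⇛⁻ φs (⇒⁻ p q) qs

module _ {Ax : Fm → Set} where

  mp* : ∀ {φs ψ} → All (Thm Ax) φs → Thm Ax (φs ⇛ ψ) → Thm Ax ψ
  mp* []       t = t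
  mp* (p ∷ ps) t = mp* ps (mp p t)

  -- The semantic hypothesis makes `φs ⇛ ψ` a tautology, and modus ponens discharges `φs`.
  -- Propositional steps can thus be argued at a valuation, for which boxed formulas are atoms.
  tautological : ∀ {φs ψ} → All (Thm Ax) φs → (∀ v → All (v ⊨_) φs → v ⊨ ψ) → Thm Ax ψ
  tautological {φs} ps f = mp* ps (taut λ v → Equivalence.to T-≡ (holds (⇛⁺ φs (f v))))

  □-mono : ∀ {φ ψ} → Thm Ax (φ ⇒ ψ) → Thm Ax (□ φ ⇒ □ ψ)
  □-mono t = mp (nec t) (axK _ _)

  □-cong : ∀ {φ ψ} → Thm Ax (φ ⇔ᶠ ψ) → Thm Ax (□ φ ⇔ᶠ □ ψ)
  □-cong t = tautological
    ( □-mono (tautological (t ∷ []) λ { v (p ∷ []) → proj₁ (⋀⁻ p) })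
    ∷ □-mono (tautological (t ∷ []) λ { v (p ∷ []) → proj₂ (⋀⁻ p) }) ∷ [])
    λ { v (p ∷ q ∷ []) → ⋀⁺ p q }

  -- Axiom K, applied once for each formula of `φs`.
  □-⇛ : ∀ φs ψ → Thm Ax (□ (φs ⇛ ψ) ⇒ (map □_ φs ⇛ □ ψ))
  □-⇛ []       ψ = tautological [] λ v _ → ⇒⁺ id
  □-⇛ (φ ∷ φs) ψ = tautological (axK φ (φs ⇛ ψ) ∷ □-⇛ φs ψ ∷ [])
    λ { v (p ∷ q ∷ []) → ⇒⁺ λ r → ⇒⁺ λ s → ⇒⁻ q (⇒⁻ (⇒⁻ p r) s) }

Thm-mono : ∀ {Ax Ax′ φ} → (∀ {ψ} → Ax ψ → Ax′ ψ) → Thm Ax φ → Thm Ax′ φ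
Thm-mono f (ax a)    = ax (f a)
Thm-mono f (taut t)  = taut t
Thm-mono f (axK φ ψ) = axK φ ψ
Thm-mono f (mp t u)  = mp (Thm-mono f t) (Thm-mono f u)
Thm-mono f (nec t)   = nec (Thm-mono f t)

-- Löb's axiom for □⁺ φ, whose antecedent follows from □ φ by K.
GL-□⇒□□⁺ : ∀ φ → GL (□ φ ⇒ □ □⁺ φ)
GL-□⇒□□⁺ φ = tautological
  ( □-mono (tautological (□-mono □⁺φ⇒φ ∷ []) λ { v (p ∷ []) → ⇒⁺ λ q → ⇒⁺ λ r → ⋀⁺ (⇒⁻ p r) q })
  ∷ ax (□⁺ φ , refl) ∷ [])
  λ { v (p ∷ q ∷ []) → ⇒⁺ λ r → ⇒⁻ q (⇒⁻ p r) }
  where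
  □⁺φ⇒φ : GL (□⁺ φ ⇒ φ)
  □⁺φ⇒φ = tautological [] λ v _ → ⇒⁺ (proj₂ ∘ ⋀⁻)

infix 3 _⊢_
-- Global consequence over GL: `nec` may be applied to members of `Γ`, as the necessitation rule of
-- a rule system permits. `Thm` has no substitution rule, so the variables of `Γ` stay fixed.
_⊢_ : List Fm → Fm → Set
Γ ⊢ φ = Thm (λ ψ → GL ψ ⊎ ψ ∈ₗ Γ) φ

hyp : ∀ {Γ φ} → φ ∈ₗ Γ → Γ ⊢ φ
hyp = ax ∘ inj₂

-- Modal rule systems over GL

derivable-isModalRuleSystem : ∀ B → IsModalRuleSystem (Derivable B)
derivable-isModalRuleSystem B = record
  { reflexivity   = reflexivity
  ; weakening     = weakening
  ; cut           = cut
  ; structural    = structural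
  ; modusPonens   = modusPonens
  ; necessitation = necessitation
  ; containsK     = containsK
  }

derivable-least : ∀ {B M} → IsModalRuleSystem M → (∀ r → B r → M r) → ∀ r → Derivable B r → M r
derivable-least {B} {M} isM B⊆M _ = go
  where
  module M = IsModalRuleSystem isM
  go : ∀ {r} → Derivable B r → M r
  go (base b)             = B⊆M _ b
  go (reflexivity φ)      = M.reflexivity φ
  go (weakening d p q)    = M.weakening (go d) p q
  go (cut φ d e)          = M.cut φ (go d) (go e)
  go (structural σ d)     = M.structural σ (go d)
  go (modusPonens φ ψ)    = M.modusPonens φ ψ
  go (necessitation φ)    = M.necessitation φ
  go (containsK k)        = M.containsK k

GLR⊕-inNExt : ∀ Ξ → InNExtGLR (GLR⊕ Ξ)
GLR⊕-inNExt Ξ =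
  derivable-isModalRuleSystem _ ,
  derivable-least (derivable-isModalRuleSystem _) (λ _ → base ∘ inj₁)

module RuleSystem {M : Rule → Set} (M∈NExt : InNExtGLR M) where

  private module M = IsModalRuleSystem (proj₁ M∈NExt)

  -- By induction on the Hilbert derivation: `mp` becomes two cuts against the modus ponens rule,
  -- `nec` one cut against the necessitation rule.
  sound : ∀ {Γ φ} → Γ ⊢ φ → M (Γ / [ φ ])
  sound (ax (inj₁ g)) = M.weakening (proj₂ M∈NExt _ (base (_ , g , refl))) (λ ()) id
  sound (ax (inj₂ m)) = M.weakening (M.reflexivity _) (λ { (here refl) → m }) id
  sound (taut t)      = M.weakening (M.containsK (taut t)) (λ ()) id
  sound (axK φ ψ)     = M.weakening (M.containsK (axK φ ψ)) (λ ()) id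
  sound (mp {φ} {ψ} t u) = M.cut φ
    (M.weakening (sound t) id (λ { (here e) → here e }))
    (M.cut (φ ⇒ ψ)
      (M.weakening (sound u) there (λ { (here e) → here e }))
      (M.weakening (M.modusPonens φ ψ)
        (λ { (here e) → there (here e) ; (there (here e)) → here e }) id))
  sound (nec {φ} t) = M.cut φ
    (M.weakening (sound t) id (λ { (here e) → here e }))
    (M.weakening (M.necessitation φ) (λ { (here e) → here e }) id)

  sound-∈ : ∀ {Γ Δ φ} → Γ ⊢ φ → φ ∈ₗ Δ → M (Γ / Δ)
  sound-∈ t φ∈Δ = M.weakening (sound t) id (λ { (here refl) → φ∈Δ })

  cut-premises : ∀ {Γ Δ} Φ → All (Γ ⊢_) Φ → M ((Φ ++ Γ) / Δ) → M (Γ / Δ)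
  cut-premises []      []       m = m
  cut-premises (φ ∷ Φ) (t ∷ ts) m = cut-premises Φ ts
    (M.cut φ (M.weakening (sound t) (xs⊆ys++xs _ Φ) (λ { (here e) → here e })) m)

  cut-conclusions : ∀ {Γ Δ} Φ → All (λ φ → M ((φ ∷ Γ) / Δ)) Φ → M (Γ / (Φ ++ Δ)) → M (Γ / Δ)
  cut-conclusions []      []       m = m
  cut-conclusions (φ ∷ Φ) (t ∷ ts) m = cut-conclusions Φ ts
    (M.cut φ m (M.weakening t id (xs⊆ys++xs _ Φ)))

  -- This is how a rule already in `M`, usually a substitution instance, is applied: its premises
  -- are proved from `Γ′`, and each of its conclusions is cut away.
  cut* : ∀ {Γ Δ Γ′ Δ′} → M (Γ / Δ) → All (Γ′ ⊢_) Γ → All (λ δ → M ((δ ∷ Γ′) / Δ′)) Δ → M (Γ′ / Δ′)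
  cut* {Γ} {Δ} {Γ′} {Δ′} m ts us =
    cut-premises Γ ts (cut-conclusions Δ
      (All.map (λ u → M.weakening u (∷⁺ʳ _ (xs⊆ys++xs Γ′ Γ)) id) us)
      (M.weakening m (xs⊆xs++ys Γ Γ′) (xs⊆xs++ys Δ Δ′)))

  -- Cutting on `f x` for each `x` in turn puts it among the conclusions in one branch and among the
  -- premises in the other. `shift` moves the new formula from its place behind the later ones to
  -- the head of the list.
  cut-split : ∀ {X : Set} (f : X → Fm) xs {Γ Δ} →
    (∀ ys zs → (∀ {x} → x ∈ₗ xs → x ∈ₗ ys ⊎ x ∈ₗ zs) → M ((map f ys ++ Γ) / (map f zs ++ Δ))) →
    M (Γ / Δ)
  cut-split f []       h = h [] [] (λ ())
  cut-split f (x ∷ xs) {Γ} {Δ} h = M.cut (f x)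
    (cut-split f xs λ ys zs c → M.weakening (h ys (x ∷ zs) λ where
       (here refl) → inj₂ (here refl)
       (there i)   → Sum.map₂ there (c i)) id (∈-resp-↭ (↭-sym (shift _ (map f zs) _))))
    (cut-split f xs λ ys zs c → M.weakening (h (x ∷ ys) zs λ where
       (here refl) → inj₁ (here refl)
       (there i)   → Sum.map₁ there (c i)) (∈-resp-↭ (↭-sym (shift _ (map f ys) _))) id)

-- Pre-stable canonical rules

-- A boxed formula counts as an atom, since `evalB` does not look under boxes; its scope is
-- inspected as well, because evaluation in an algebra does.
AllAtoms : (Fm → Set) → Fm → Set
AllAtoms P (var x) = P (var x)
AllAtoms P ⊥̇       = Unit.⊤
AllAtoms P ⊤̇       = Unit.⊤
AllAtoms P (~ φ)   = AllAtoms P φ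
AllAtoms P (φ ⋀ ψ) = AllAtoms P φ × AllAtoms P ψ
AllAtoms P (φ ⋁ ψ) = AllAtoms P φ × AllAtoms P ψ
AllAtoms P (φ ⇒ ψ) = AllAtoms P φ × AllAtoms P ψ
AllAtoms P (□ φ)   = P (□ φ) × AllAtoms P φ

vars : Fm → List Fm
vars (var x) = [ var x ]
vars ⊥̇       = []
vars ⊤̇       = []
vars (~ φ)   = vars φ
vars (φ ⋀ ψ) = vars φ ++ vars ψ
vars (φ ⋁ ψ) = vars φ ++ vars ψ
vars (φ ⇒ ψ) = vars φ ++ vars ψ
vars (□ φ)   = vars φ

boxed : Fm → List Fm
boxed (var x) = []
boxed ⊥̇       = []
boxed ⊤̇       = []
boxed (~ φ)   = boxed φ
boxed (φ ⋀ ψ) = boxed φ ++ boxed ψ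
boxed (φ ⋁ ψ) = boxed φ ++ boxed ψ
boxed (φ ⇒ ψ) = boxed φ ++ boxed ψ
boxed (□ φ)   = φ ∷ boxed φ

atoms : Fm → List Fm
atoms φ = vars φ ++ map □_ (boxed φ)

module _ {P : Fm → Set} where

  AllAtoms⁺ : ∀ φ → All P (vars φ) → All (P ∘ □_) (boxed φ) → AllAtoms P φ
  private
    both : ∀ φ ψ → All P (vars φ ++ vars ψ) → All (P ∘ □_) (boxed φ ++ boxed ψ) →
           AllAtoms P φ × AllAtoms P ψ

  AllAtoms⁺ (var x) (p ∷ []) bs = p
  AllAtoms⁺ ⊥̇       vs bs       = tt
  AllAtoms⁺ ⊤̇       vs bs       = tt
  AllAtoms⁺ (~ φ)   vs bs       = AllAtoms⁺ φ vs bs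
  AllAtoms⁺ (φ ⋀ ψ) vs bs       = both φ ψ vs bs
  AllAtoms⁺ (φ ⋁ ψ) vs bs       = both φ ψ vs bs
  AllAtoms⁺ (φ ⇒ ψ) vs bs       = both φ ψ vs bs
  AllAtoms⁺ (□ φ)   vs (b ∷ bs) = b , AllAtoms⁺ φ vs bs

  both φ ψ vs bs =
    AllAtoms⁺ φ (All.++⁻ˡ (vars φ) vs) (All.++⁻ˡ (boxed φ) bs) ,
    AllAtoms⁺ ψ (All.++⁻ʳ (vars φ) vs) (All.++⁻ʳ (boxed φ) bs)

  AllAtoms-boxed : ∀ φ → AllAtoms P φ → All (AllAtoms P) (boxed φ)
  AllAtoms-boxed (var x) a       = []
  AllAtoms-boxed ⊥̇       a       = []
  AllAtoms-boxed ⊤̇       a       = []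
  AllAtoms-boxed (~ φ)   a       = AllAtoms-boxed φ a
  AllAtoms-boxed (φ ⋀ ψ) (a , b) = All.++⁺ (AllAtoms-boxed φ a) (AllAtoms-boxed ψ b)
  AllAtoms-boxed (φ ⋁ ψ) (a , b) = All.++⁺ (AllAtoms-boxed φ a) (AllAtoms-boxed ψ b)
  AllAtoms-boxed (φ ⇒ ψ) (a , b) = All.++⁺ (AllAtoms-boxed φ a) (AllAtoms-boxed ψ b)
  AllAtoms-boxed (□ φ)   (_ , a) = a ∷ AllAtoms-boxed φ a

AllAtoms-atoms : ∀ φ → AllAtoms (_∈ₗ atoms φ) φ
AllAtoms-atoms φ = AllAtoms⁺ φ (All.tabulate ∈-++⁺ˡ) (All.tabulate (∈-++⁺ʳ (vars φ) ∘ ∈-map⁺ □_))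

⋀* : List Fm → Fm
⋀* = foldr _⋀_ ⊤̇

AllAtoms-⋀*⁻ : ∀ {P} Φ → AllAtoms P (⋀* Φ) → All (AllAtoms P) Φ
AllAtoms-⋀*⁻ []      _       = []
AllAtoms-⋀*⁻ (φ ∷ Φ) (a , b) = a ∷ AllAtoms-⋀*⁻ Φ b

module _ {v : Val} where

  ⋀*⁺ : ∀ {Φ} → All (v ⊨_) Φ → v ⊨ ⋀* Φ
  ⋀*⁺ []       = ⟨ tt ⟩
  ⋀*⁺ (p ∷ ps) = ⋀⁺ p (⋀*⁺ ps)

  ⋀*⁻ : ∀ Φ → v ⊨ ⋀* Φ → All (v ⊨_) Φ
  ⋀*⁻ []      _ = []
  ⋀*⁻ (φ ∷ Φ) p = let q , r = ⋀⁻ p in q ∷ ⋀*⁻ Φ r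

module Canonical {n} (𝔄 : FinModalAlgebra n) (D⁺ D : Subset n) where

  open FinModalAlgebra 𝔄

  p : Fin n → Fm
  p a = var (toℕ a)

  premises conclusions : List Fm
  premises    = Rule.prem (ξ⁺ 𝔄 D⁺ D)
  conclusions = Rule.conc (ξ⁺ 𝔄 D⁺ D)

  private
    A : List (Fin n)
    A = allFin n

    ∧s ∨s ¬s □⁺s D⁺s : List Fm
    ∧s  = cartesianProductWith (λ a b → p (a ∧ᴬ b) ⇔ᶠ (p a ⋀ p b)) A A
    ∨s  = cartesianProductWith (λ a b → p (a ∨ᴬ b) ⇔ᶠ (p a ⋁ p b)) A A
    ¬s  = map (λ a → p (¬ᴬ a) ⇔ᶠ (~ p a)) A
    □⁺s = map (λ a → p (□⁺ᴬ a) ⇒ (□⁺ p a)) A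
    D⁺s = map (λ a → (□⁺ p a) ⇒ p (□⁺ᴬ a)) (filter (_∈? D⁺) A)

  ∧-premise : ∀ a b → (p (a ∧ᴬ b) ⇔ᶠ (p a ⋀ p b)) ∈ₗ premises
  ∧-premise a b = ∈-++⁺ˡ (∈-cartesianProductWith⁺ _ (∈-allFin a) (∈-allFin b))

  ∨-premise : ∀ a b → (p (a ∨ᴬ b) ⇔ᶠ (p a ⋁ p b)) ∈ₗ premises
  ∨-premise a b = ∈-++⁺ʳ ∧s (∈-++⁺ˡ (∈-cartesianProductWith⁺ _ (∈-allFin a) (∈-allFin b)))

  ¬-premise : ∀ a → (p (¬ᴬ a) ⇔ᶠ (~ p a)) ∈ₗ premises
  ¬-premise a = ∈-++⁺ʳ ∧s (∈-++⁺ʳ ∨s (∈-++⁺ˡ (∈-map⁺ _ (∈-allFin a))))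

  □-premise : ∀ {a} → a ∈ D → (p (□ᴬ a) ⇔ᶠ (□ p a)) ∈ₗ premises
  □-premise {a} a∈D = ∈-++⁺ʳ ∧s (∈-++⁺ʳ ∨s (∈-++⁺ʳ ¬s (∈-++⁺ʳ □⁺s (∈-++⁺ʳ D⁺s
    (∈-map⁺ _ (∈-filter⁺ (_∈? D) (∈-allFin a) a∈D))))))

  conclusion : ∀ {a} → a ≢ 1ᴬ → p a ∈ₗ conclusions
  conclusion {a} a≢1 = ∈-map⁺ p (∈-filter⁺ (λ b → ¬? (b ≟ 1ᴬ)) (∈-allFin a) a≢1)

  -- One hypothesis for each of the six blocks of premises, so that later arguments need not take
  -- the concatenated list apart.
  premises-All : ∀ {P : Fm → Set} →
    (∀ a b → P (p (a ∧ᴬ b) ⇔ᶠ (p a ⋀ p b))) →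
    (∀ a b → P (p (a ∨ᴬ b) ⇔ᶠ (p a ⋁ p b))) →
    (∀ a → P (p (¬ᴬ a) ⇔ᶠ (~ p a))) →
    (∀ a → P (p (□⁺ᴬ a) ⇒ (□⁺ p a))) →
    (∀ {a} → a ∈ D⁺ → P ((□⁺ p a) ⇒ p (□⁺ᴬ a))) →
    (∀ {a} → a ∈ D → P (p (□ᴬ a) ⇔ᶠ (□ p a))) →
    All P premises
  premises-All {P} h∧ h∨ h¬ h□⁺ hD⁺ hD =
    All.++⁺ (product h∧) (All.++⁺ (product h∨) (All.++⁺ (All.map⁺ (All.universal h¬ A))
      (All.++⁺ (All.map⁺ (All.universal h□⁺ A))
        (All.++⁺ (All.map⁺ (All.map hD⁺ (All.all-filter (_∈? D⁺) A)))
          (All.map⁺ (All.map hD (All.all-filter (_∈? D) A)))))))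
    where
    product : ∀ {f : Fin n → Fin n → Fm} → (∀ a b → P (f a b)) → All P (cartesianProductWith f A A)
    product {f} h = All.tabulate λ i → case-product (∈-cartesianProductWith⁻ f A A i)
      where
      case-product : ∀ {φ} → ∃ (λ a → ∃ λ b → a ∈ₗ A × b ∈ₗ A × φ ≡ f a b) → P φ
      case-product (a , b , _ , _ , refl) = h a b

  conclusions-All : ∀ {P : Fm → Set} → (∀ {a} → a ≢ 1ᴬ → P (p a)) → All P conclusions
  conclusions-All h = All.map⁺ (All.map h (All.all-filter (λ a → ¬? (a ≟ 1ᴬ)) A))

module Valuation {n} (𝔄 : FinModalAlgebra n) (V : ℕ → Fin n) where

  open FinModalAlgebra 𝔄

  ⟦_⟧ : Fm → Fin n
  ⟦ var x ⟧ = V x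
  ⟦ ⊥̇ ⟧     = 0ᴬ
  ⟦ ⊤̇ ⟧     = 1ᴬ
  ⟦ ~ φ ⟧   = ¬ᴬ ⟦ φ ⟧
  ⟦ φ ⋀ ψ ⟧ = ⟦ φ ⟧ ∧ᴬ ⟦ ψ ⟧
  ⟦ φ ⋁ ψ ⟧ = ⟦ φ ⟧ ∨ᴬ ⟦ ψ ⟧
  ⟦ φ ⇒ ψ ⟧ = (¬ᴬ ⟦ φ ⟧) ∨ᴬ ⟦ ψ ⟧
  ⟦ □ φ ⟧   = □ᴬ ⟦ φ ⟧

  module _ (D⁺ D : Subset n) {P : Fm → Set} (P-box : ∀ φ → P (□ φ) → ⟦ φ ⟧ ∈ D) where

    open Canonical 𝔄 D⁺ D
    open IsBooleanAlgebra isBooleanAlgebra using (∨-complementʳ; ∧-complementʳ)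

    -- The constants have no premises of their own, so 1 is written as the join of 0 and its
    -- complement, and excluded middle applies. Dually for 0 below.
    premises⊢p1 : premises ⊢ p 1ᴬ
    premises⊢p1 = subst (λ a → premises ⊢ p a) (∨-complementʳ 0ᴬ)
      (tautological (hyp (∨-premise 0ᴬ (¬ᴬ 0ᴬ)) ∷ hyp (¬-premise 0ᴬ) ∷ [])
        λ { v (h ∷ k ∷ []) → ⇔⁻² h (⋁⁺ (excluded-middle k)) })
      where
      excluded-middle : ∀ {v φ ψ} → v ⊨ ψ ⇔ᶠ (~ φ) → v ⊨ φ ⊎ v ⊨ ψ
      excluded-middle {v} {φ} k with v ⊨? φ
      ... | yes h = inj₁ h
      ... | no ¬h = inj₂ (⇔⁻² k (~⁺ ¬h))

    premises⊢~p0 : premises ⊢ ~ p 0ᴬ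
    premises⊢~p0 = subst (λ a → premises ⊢ ~ p a) (∧-complementʳ 0ᴬ)
      (tautological (hyp (∧-premise 0ᴬ (¬ᴬ 0ᴬ)) ∷ hyp (¬-premise 0ᴬ) ∷ [])
        λ { v (h ∷ k ∷ []) → ~⁺ λ q → let q₁ , q₂ = ⋀⁻ (⇔⁻¹ h q) in ~⁻ (⇔⁻¹ k q₂) q₁ })

    naming : ℕ → Fm
    naming x = p (V x)

    -- The Boolean premises handle the Boolean connectives. At `□ φ` the induction hypothesis passes
    -- under the box by `□-cong`, and `P-box` puts `⟦ φ ⟧` in `D`, where the rule equates `p (□ᴬ a)`
    -- with `□ p a`.
    premises⊢⇔p : ∀ ψ → AllAtoms P ψ → premises ⊢ (ψ ⟪ naming ⟫) ⇔ᶠ p ⟦ ψ ⟧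
    premises⊢⇔p (var x) _ = tautological [] λ v _ → ⇔⁺ id id
    premises⊢⇔p ⊥̇ _ = tautological (premises⊢~p0 ∷ [])
      λ { v (h ∷ []) → ⇔⁺ (λ ()) (λ q → contradiction q (~⁻ h)) }
    premises⊢⇔p ⊤̇ _ = tautological (premises⊢p1 ∷ []) λ { v (h ∷ []) → ⇔⁺ (λ _ → h) (λ _ → ⟨ tt ⟩) }
    premises⊢⇔p (~ φ) a = tautological (premises⊢⇔p φ a ∷ hyp (¬-premise ⟦ φ ⟧) ∷ [])
      λ { v (h ∷ k ∷ []) → ⇔⁺
        (λ q → ⇔⁻² k (~⁺ λ r → ~⁻ q (⇔⁻² h r)))
        (λ q → ~⁺ λ r → ~⁻ (⇔⁻¹ k q) (⇔⁻¹ h r)) }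
    premises⊢⇔p (φ ⋀ ψ) (a , b) = tautological
      (premises⊢⇔p φ a ∷ premises⊢⇔p ψ b ∷ hyp (∧-premise ⟦ φ ⟧ ⟦ ψ ⟧) ∷ [])
      λ { v (h ∷ k ∷ l ∷ []) → ⇔⁺
        (λ q → let q₁ , q₂ = ⋀⁻ q in ⇔⁻² l (⋀⁺ (⇔⁻¹ h q₁) (⇔⁻¹ k q₂)))
        (λ q → let q₁ , q₂ = ⋀⁻ (⇔⁻¹ l q) in ⋀⁺ (⇔⁻² h q₁) (⇔⁻² k q₂)) }
    premises⊢⇔p (φ ⋁ ψ) (a , b) = tautological
      (premises⊢⇔p φ a ∷ premises⊢⇔p ψ b ∷ hyp (∨-premise ⟦ φ ⟧ ⟦ ψ ⟧) ∷ [])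
      λ { v (h ∷ k ∷ l ∷ []) → ⇔⁺
        (λ q → ⇔⁻² l (⋁⁺ (Sum.map (⇔⁻¹ h) (⇔⁻¹ k) (⋁⁻ q))))
        (λ q → ⋁⁺ (Sum.map (⇔⁻² h) (⇔⁻² k) (⋁⁻ (⇔⁻¹ l q)))) }
    premises⊢⇔p (φ ⇒ ψ) (a , b) = tautological
      (premises⊢⇔p φ a ∷ premises⊢⇔p ψ b ∷ hyp (¬-premise ⟦ φ ⟧) ∷ hyp (∨-premise (¬ᴬ ⟦ φ ⟧) ⟦ ψ ⟧) ∷ [])
      λ { v (h ∷ k ∷ m ∷ l ∷ []) → ⇔⁺
        (λ q → ⇔⁻² l (⋁⁺ (implication h k m q)))
        (λ q → ⇒⁺ λ r → Sum.[ (λ s → contradiction (⇔⁻¹ h r) (~⁻ (⇔⁻¹ m s))) , ⇔⁻² k ] (⋁⁻ (⇔⁻¹ l q))) }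
      where
      implication : ∀ {v φ ψ χ θ ρ} → v ⊨ φ ⇔ᶠ χ → v ⊨ ψ ⇔ᶠ θ → v ⊨ ρ ⇔ᶠ (~ χ) → v ⊨ φ ⇒ ψ → v ⊨ ρ ⊎ v ⊨ θ
      implication {v} {χ = χ} h k m q with v ⊨? χ
      ... | yes r = inj₂ (⇔⁻¹ k (⇒⁻ q (⇔⁻² h r)))
      ... | no ¬r = inj₁ (⇔⁻² m (~⁺ ¬r))
    premises⊢⇔p (□ φ) (a , b) = tautological
      (□-cong (premises⊢⇔p φ b) ∷ hyp (□-premise (P-box φ a)) ∷ [])
      λ { v (h ∷ k ∷ []) → ⇔⁺ (⇔⁻² k ∘ ⇔⁻¹ h) (⇔⁻² h ∘ ⇔⁻¹ k) }

    -- Substitute for each variable the letter of its value. Each formula of `Γ` then becomes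
    -- equivalent to `p 1ᴬ`, which is provable, and each formula of `Δ` to some `p a` with `a ≢ 1ᴬ`,
    -- which is a conclusion of `ξ⁺`.
    refuted⇒ξ⁺ : ∀ {M Γ Δ} → InNExtGLR M →
      All (AllAtoms P) Γ → All (AllAtoms P) Δ →
      All (λ γ → ⟦ γ ⟧ ≡ 1ᴬ) Γ → All (λ δ → ⟦ δ ⟧ ≢ 1ᴬ) Δ →
      M (Γ / Δ) → M (ξ⁺ 𝔄 D⁺ D)
    refuted⇒ξ⁺ {M} M∈NExt Γ-atoms Δ-atoms Γ≡1 Δ≢1 m =
      cut* (IsModalRuleSystem.structural (proj₁ M∈NExt) naming m)
        (All.map⁺ (All.zipWith (λ { {γ} (a , eq) → true-premise γ a eq }) (Γ-atoms , Γ≡1)))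
        (All.map⁺ (All.zipWith (λ { {δ} (a , neq) → false-conclusion δ a neq }) (Δ-atoms , Δ≢1)))
      where
      open RuleSystem M∈NExt
      true-premise : ∀ γ → AllAtoms P γ → ⟦ γ ⟧ ≡ 1ᴬ → premises ⊢ γ ⟪ naming ⟫
      true-premise γ a eq = tautological
        (premises⊢⇔p γ a ∷ subst (λ b → premises ⊢ p b) (sym eq) premises⊢p1 ∷ [])
        λ { v (h ∷ k ∷ []) → ⇔⁻² h k }
      false-conclusion : ∀ δ → AllAtoms P δ → ⟦ δ ⟧ ≢ 1ᴬ → M (((δ ⟪ naming ⟫) ∷ premises) / conclusions)
      false-conclusion δ a neq = sound-∈
        (tautological (hyp (here refl) ∷ ⊢-weaken (premises⊢⇔p δ a) ∷ [])
          λ { v (h ∷ k ∷ []) → ⇔⁻¹ k h })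
        (conclusion neq)
        where
        ⊢-weaken : ∀ {Γ φ ψ} → Γ ⊢ φ → (ψ ∷ Γ) ⊢ φ
        ⊢-weaken = Thm-mono (Sum.map₂ there)

-- Filtration

Agree : List Fm → Val → Val → Set
Agree αs w s = All (λ α → w α ≡ s α) αs

agree? : ∀ αs w s → Dec (Agree αs w s)
agree? αs w s = All.all? (λ α → w α Bool.≟ s α) αs

_[_↦_] : Val → Fm → Bool → Val
(s [ α ↦ b ]) β = if eqᶠ α β then b else s β

-- Representatives of all truth assignments to `αs`, with `false` as default elsewhere. If `αs` has
-- repetitions, so does the list up to agreement, which `thin` repairs.
valuations : List Fm → List Val
valuations []       = [ const false ]
valuations (α ∷ αs) = map (_[ α ↦ true ]) (valuations αs) ++ map (_[ α ↦ false ]) (valuations αs)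

valuations-cover : ∀ αs w → Any (Agree αs w) (valuations αs)
valuations-cover []       w = here []
valuations-cover (α ∷ αs) w = place (w α) refl
  where
  update-agree : ∀ {b s} → w α ≡ b → Agree αs w s → Agree (α ∷ αs) w (s [ α ↦ b ])
  update-agree {b} {s} wα≡b ag = at (here refl) ∷ All.tabulate (at ∘ there)
    where
    at : ∀ {β} → β ∈ₗ α ∷ αs → w β ≡ (s [ α ↦ b ]) β
    at (here refl) rewrite Equivalence.to T-≡ (eqᶠ-refl α) = wα≡b
    -- If `α` occurs again in `αs`, the update overwrites that occurrence too, but with `b`, which
    -- is the value of `w` there.
    at {β} (there β∈αs) with eqᶠ α β in α≡β
    ... | true  = subst (λ γ → w γ ≡ b) (eqᶠ-sound α β (Equivalence.from T-≡ α≡β)) wα≡b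
    ... | false = All.lookup ag β∈αs

  updated : ∀ {b} → w α ≡ b → Any (Agree (α ∷ αs) w) (map (_[ α ↦ b ]) (valuations αs))
  updated e = Any.map⁺ (Any.map (update-agree e) (valuations-cover αs w))

  place : ∀ b → w α ≡ b → Any (Agree (α ∷ αs) w) (valuations (α ∷ αs))
  place true  e = Any.++⁺ˡ (updated e)
  place false e = Any.++⁺ʳ (map (_[ α ↦ true ]) (valuations αs)) (updated e)

module _ (αs : List Fm) where

  agree-sym : ∀ {w s} → Agree αs w s → Agree αs s w
  agree-sym = All.map sym

  agree-trans : ∀ {w s t} → Agree αs w s → Agree αs s t → Agree αs w t
  agree-trans p q = All.zipWith (λ { (e , f) → trans e f }) (p , q)

  Distinct : List Val → Set
  Distinct = AllPairs (λ s t → ¬ Agree αs s t)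

  -- Points of the frame will be indices into a list of states; dropping duplicates up to agreement
  -- ensures that distinct indices have incompatible descriptions.
  thin : ∀ ss → ∃ λ ts → Distinct ts × ts ⊆ ss × (∀ {w} → Any (Agree αs w) ss → Any (Agree αs w) ts)
  thin [] = [] , [] , (λ ()) , id
  thin (s ∷ ss) with thin ss
  ... | ts , ts-distinct , ts⊆ss , covers with Any.any? (agree? αs s) ts
  ...   | yes s∈ts = ts , ts-distinct , there ∘ ts⊆ss , λ where
            (here p)  → Any.map (agree-trans p) s∈ts
            (there p) → covers p
  ...   | no s∉ts  = s ∷ ts , All.¬Any⇒All¬ ts s∉ts ∷ ts-distinct ,
            (λ { (here e) → here e ; (there i) → there (ts⊆ss i) }) , λ where
            (here p)  → here p
            (there p) → there (covers p)

  distinct-lookup : ∀ {ss} → Distinct ss → ∀ i j → Agree αs (lookup ss i) (lookup ss j) → i ≡ j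
  distinct-lookup (_ ∷ _)        zero    zero    _  = refl
  distinct-lookup {_ ∷ ss} (h ∷ _) zero    (suc j) ag = contradiction ag (All.lookup h (∈-lookup j))
  distinct-lookup {_ ∷ ss} (h ∷ _) (suc i) zero    ag = contradiction (agree-sym ag) (All.lookup h (∈-lookup i))
  distinct-lookup (_ ∷ d)        (suc i) (suc j) ag = cong suc (distinct-lookup d i j ag)

  eval-local : ∀ {w s} φ → AllAtoms (_∈ₗ αs) φ → Agree αs w s → evalB w φ ≡ evalB s φ
  eval-local (var x) a ag       = All.lookup ag a
  eval-local ⊥̇       a ag       = refl
  eval-local ⊤̇       a ag       = refl
  eval-local (~ φ)   a ag       = cong not (eval-local φ a ag)
  eval-local (φ ⋀ ψ) (a , b) ag = cong₂ _∧_ (eval-local φ a ag) (eval-local ψ b ag)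
  eval-local (φ ⋁ ψ) (a , b) ag = cong₂ _∨_ (eval-local φ a ag) (eval-local ψ b ag)
  eval-local (φ ⇒ ψ) (a , b) ag = cong₂ (λ x y → not x ∨ y) (eval-local φ a ag) (eval-local ψ b ag)
  eval-local (□ φ)   (a , _) ag = All.lookup ag a

  ⊨-local : ∀ {w s φ} → AllAtoms (_∈ₗ αs) φ → Agree αs w s → w ⊨ φ → s ⊨ φ
  ⊨-local {φ = φ} a ag ⟨ h ⟩ = ⟨ subst T (eval-local φ a ag) h ⟩

vars-All : ∀ {P : Fm → Set} → (∀ x → P (var x)) → ∀ φ → All P (vars φ)
vars-All h (var x) = h x ∷ []
vars-All h ⊥̇       = []
vars-All h ⊤̇       = []
vars-All h (~ φ)   = vars-All h φ
vars-All h (φ ⋀ ψ) = All.++⁺ (vars-All h φ) (vars-All h ψ)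
vars-All h (φ ⋁ ψ) = All.++⁺ (vars-All h φ) (vars-All h ψ)
vars-All h (φ ⇒ ψ) = All.++⁺ (vars-All h φ) (vars-All h ψ)
vars-All h (□ φ)   = vars-All h φ

atoms-atomic : ∀ φ → All (λ α → ∀ v → evalB v α ≡ v α) (atoms φ)
atoms-atomic φ = All.++⁺ (vars-All (λ _ _ → refl) φ) (All.map⁺ (All.universal (λ _ _ → refl) (boxed φ)))

boxed-atom : ∀ {φ} θ → φ ∈ₗ boxed θ → (□ φ) ∈ₗ atoms θ
boxed-atom θ = ∈-++⁺ʳ (vars θ) ∘ ∈-map⁺ □_

-- Read off from a property of all atoms that is vacuous for variables, so that only the boxed part
-- of the list matters.
box-atom : ∀ {φ} θ → (□ φ) ∈ₗ atoms θ → φ ∈ₗ boxed θ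
box-atom {φ} θ i = All.lookup
  (All.++⁺ (vars-All {P = IsBoxed} (λ _ _ ()) θ) (All.map⁺ (All.tabulate λ { i _ refl → i }))) i φ refl
  where
  IsBoxed : Fm → Set
  IsBoxed α = ∀ φ → α ≡ □ φ → φ ∈ₗ boxed θ

⋁* : List Fm → Fm
⋁* = foldr _⋁_ ⊥̇

⋁*⁺ : ∀ {v Φ} → Any (v ⊨_) Φ → v ⊨ ⋁* Φ
⋁*⁺ (here p)  = ⋁⁺ (inj₁ p)
⋁*⁺ (there p) = ⋁⁺ (inj₂ (⋁*⁺ p))

⋁*⁻ : ∀ {v} Φ → v ⊨ ⋁* Φ → Any (v ⊨_) Φ
⋁*⁻ []      ⟨ () ⟩
⋁*⁻ (φ ∷ Φ) p with ⋁⁻ p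
... | inj₁ q = here q
... | inj₂ q = there (⋁*⁻ Φ q)

literal : Val → Fm → Fm
literal s α = if s α then α else ~ α

-- State descriptions

module States (θ : Fm) where

  infix 4 _∼_
  _∼_ : Val → Val → Set
  _∼_ = Agree (atoms θ)

  Local : Fm → Set
  Local = AllAtoms (_∈ₗ atoms θ)

  boxed-local : All Local (boxed θ)
  boxed-local = AllAtoms-boxed θ (AllAtoms-atoms θ)

  χ : Val → Fm
  χ s = ⋀* (map (literal s) (atoms θ))

  -- On variables and boxes `evalB w` is `w` itself, so truth of the literals amounts to agreement
  -- on atoms, here and in the converse.
  χ⁺ : ∀ {w s} → w ∼ s → w ⊨ χ s
  χ⁺ {w} {s} w∼s = ⋀*⁺ (All.map⁺ (All.zipWith (λ { {α} (e , at) → literal⁺ α e (at w) }) (w∼s , atoms-atomic θ)))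
    where
    literal⁺ : ∀ α → w α ≡ s α → evalB w α ≡ w α → w ⊨ literal s α
    literal⁺ α e f with s α
    ... | true  = ⟨ subst T (sym (trans f e)) tt ⟩
    ... | false = ~⁺ λ { ⟨ h ⟩ → subst T (trans f e) h }

  χ⁻ : ∀ {w s} → w ⊨ χ s → w ∼ s
  χ⁻ {w} {s} h = All.zipWith (λ { {α} (l , at) → literal⁻ α l (at w) }) (All.map⁻ (⋀*⁻ _ h) , atoms-atomic θ)
    where
    literal⁻ : ∀ α → w ⊨ literal s α → evalB w α ≡ w α → w α ≡ s α
    literal⁻ α l f with s α | w α
    ... | true  | true  = refl
    ... | false | false = refl
    ... | true  | false = contradiction (subst T f (_⊨_.holds l)) id
    ... | false | true  = contradiction ⟨ subst T (sym f) tt ⟩ (~⁻ l)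

-- The frame of states and its complex algebra

module Filtration (θ : Fm) {m : ℕ} (state : Fin m → Val)
  (state-injective : ∀ i j → Agree (atoms θ) (state i) (state j) → i ≡ j) where

  open States θ

  R : Fin m → Fin m → Set
  R i j = All (λ φ → state i ⊨ □ φ → state j ⊨ φ × state j ⊨ □ φ) (boxed θ)

  R? : ∀ i j → Dec (R i j)
  R? i j = All.all? (λ φ → (state i ⊨? (□ φ)) →-dec ((state j ⊨? φ) ×-dec (state j ⊨? (□ φ)))) (boxed θ)

  -- A box true at `i` is handed on to `j` as a box, and so takes effect again at `k`.
  R-transitive : ∀ {i j k} → R i j → R j k → R i k
  R-transitive r r′ = All.zipWith (λ { (f , g) → g ∘ proj₂ ∘ f }) (r , r′)

  open Complex R? public
  open FinModalAlgebra algebra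

  truth : Fm → Subset m
  truth φ = comprehension λ i → state i ⊨? φ

  truth⁺ : ∀ φ {i} → state i ⊨ φ → i ∈ truth φ
  truth⁺ φ = ∈-comprehension⁺ λ i → state i ⊨? φ

  truth⁻ : ∀ φ {i} → i ∈ truth φ → state i ⊨ φ
  truth⁻ φ = ∈-comprehension⁻ λ i → state i ⊨? φ

  -- The half of the truth condition for `□ φ` that the definition of `R` does not guarantee.
  Saturated : Fin m → Fm → Set
  Saturated i φ = (∀ j → R i j → state j ⊨ φ) → state i ⊨ □ φ

  saturated? : ∀ i φ → Dec (Saturated i φ)
  saturated? i φ = (all? λ j → R? i j →-dec (state j ⊨? φ)) →-dec (state i ⊨? (□ φ))

  name : Subset m → Fm
  name U = ⋁* (map (χ ∘ state) (filter (_∈? U) (allFin m)))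

  name⁺ : ∀ {w i U} → w ∼ state i → i ∈ U → w ⊨ name U
  name⁺ {U = U} w∼i i∈U = ⋁*⁺ (Any.map⁺ (lose (∈-filter⁺ (_∈? U) (∈-allFin _) i∈U) (χ⁺ w∼i)))

  -- Some disjunct `χ (state j)` with `j ∈ U` is true at `w`, so states `j` and `i` agree, and
  -- injectivity identifies them.
  name⁻ : ∀ {w i U} → w ∼ state i → w ⊨ name U → i ∈ U
  name⁻ {w} {i} {U} w∼i h =
    let j , j∈ , w⊨χ = find (Any.map⁻ (⋁*⁻ _ h))
    in subst (_∈ U)
         (state-injective j i (agree-trans _ (agree-sym _ (χ⁻ w⊨χ)) w∼i))
         (All.lookup (All.all-filter (_∈? U) (allFin m)) j∈)

  module Theory {Γ N : List Fm} (Γ⊢N : All (Γ ⊢_) N)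
    (covering : ∀ w → All (w ⊨_) N → ∃ λ i → w ∼ state i) where

    -- Every valuation satisfying `N` matches some state by `covering`, so a consequence of `Γ` may
    -- be checked state by state.
    by-states : ∀ {Φ ψ} → All (Γ ⊢_) Φ → (∀ w i → w ∼ state i → All (w ⊨_) Φ → w ⊨ ψ) → Γ ⊢ ψ
    by-states ts h = tautological (All.++⁺ Γ⊢N ts) λ v ps →
      let i , v∼i = covering v (All.++⁻ˡ N ps) in h v i v∼i (All.++⁻ʳ N ps)

    -- Let `φs` be the scopes of the boxes true at `i`. A state satisfying `□⁺ φ` for all of them is
    -- an `R`-successor of `i`, hence in `U`. Necessitation and K turn this into an implication from
    -- the formulas `□ □⁺ φ`, which GL derives from the boxes `□ φ` contained in the description of
    -- `i`.
    □-name : ∀ {i U} → i ∈ ⊡ U → Γ ⊢ χ (state i) ⇒ □ name U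
    □-name {i} {U} i∈⊡U = tautological
      (mp (nec □⁺s⇛name) (□-⇛ (map □⁺_ φs) (name U)) ∷ All.map⁺ (All.universal four φs))
      λ { v (h ∷ hs) → ⇒⁺ λ v⊨χ → ⇛⁻ _ h (All.map⁺ (All.map⁺
          (All.zipWith (λ { (t , k) → ⇒⁻ t k }) (All.map⁻ hs , All.map (true-box v⊨χ) φs-true)))) }
      where
      φs : List Fm
      φs = filter (λ φ → state i ⊨? (□ φ)) (boxed θ)

      φs-true : All (λ φ → φ ∈ₗ boxed θ × state i ⊨ □ φ) φs
      φs-true = All.tabulate (∈-filter⁻ (λ φ → state i ⊨? (□ φ)))

      four : ∀ φ → Γ ⊢ □ φ ⇒ □ □⁺ φ
      four φ = Thm-mono inj₁ (ax (GL-□⇒□□⁺ φ))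

      -- The two conjuncts of `□⁺ φ` are the two demands that `R i j` makes at `j`.
      □⁺s⇛name : Γ ⊢ map □⁺_ φs ⇛ name U
      □⁺s⇛name = by-states [] λ w j w∼j _ → ⇛⁺ (map □⁺_ φs) λ hs → name⁺ w∼j (∈-⊡⁻ i∈⊡U j
        (All.tabulate λ {φ} φ∈ i⊨□φ →
          let w⊨□φ , w⊨φ = ⋀⁻ (All.lookup (All.map⁻ hs) (∈-filter⁺ (λ ψ → state i ⊨? (□ ψ)) φ∈ i⊨□φ))
              φ-local = All.lookup boxed-local φ∈
          in ⊨-local (atoms θ) φ-local w∼j w⊨φ , ⊨-local (atoms θ) (boxed-atom θ φ∈ , φ-local) w∼j w⊨□φ))

      true-box : ∀ {v φ} → v ⊨ χ (state i) → φ ∈ₗ boxed θ × state i ⊨ □ φ → v ⊨ □ φ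
      true-box v⊨χ (φ∈ , i⊨□φ) =
        ⊨-local (atoms θ) (boxed-atom θ φ∈ , All.lookup boxed-local φ∈) (agree-sym (atoms θ) (χ⁻ v⊨χ)) i⊨□φ

    -- The boxed conjunct comes from `□-name` for the states in `⊡ U`, the other one from membership
    -- in `U`.
    □⁺-name : ∀ U → Γ ⊢ name (⊡ U ∩ U) ⇒ □⁺ name U
    □⁺-name U = by-states (All.map⁺ (All.map □-name (All.all-filter (_∈? ⊡ U) (allFin m))))
      λ w i w∼i hs → ⇒⁺ λ h →
        let i∈⊡U , i∈U = x∈p∩q⁻ (⊡ U) U (name⁻ w∼i h)
        in ⋀⁺ (⇒⁻ (All.lookup (All.map⁻ hs) (∈-filter⁺ (_∈? ⊡ U) (∈-allFin i) i∈⊡U)) (χ⁺ w∼i)) (name⁺ w∼i i∈U)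

    name-truth : ∀ {φ} → Local φ → Γ ⊢ name (truth φ) ⇔ᶠ φ
    name-truth {φ} a = by-states [] λ w i w∼i _ → ⇔⁺
      (λ h → ⊨-local (atoms θ) a (agree-sym (atoms θ) w∼i) (truth⁻ φ (name⁻ w∼i h)))
      (λ h → name⁺ w∼i (truth⁺ φ (⊨-local (atoms θ) a w∼i h)))

    false⇒excluded : ∀ {i φ} → Local φ → Γ ⊢ φ → ¬ (state i ⊨ φ) → Γ ⊢ ~ χ (state i)
    false⇒excluded {i} a t i⊭φ = tautological (t ∷ []) λ { v (h ∷ []) →
      ~⁺ λ v⊨χ → i⊭φ (⊨-local (atoms θ) a (χ⁻ v⊨χ) h) }

    true⇒theorem : ∀ {φ} → Local φ → (∀ i → state i ⊨ φ) → Γ ⊢ φ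
    true⇒theorem a h = by-states [] λ w i w∼i _ → ⊨-local (atoms θ) a (agree-sym (atoms θ) w∼i) (h i)

    -- All successors of `i` satisfy `φ`, so by `□-name` the description of `i` implies `□ φ`; yet
    -- that description contains the negation of `□ φ`.
    unsaturated⇒excluded : ∀ {i φ} → φ ∈ₗ boxed θ → ¬ Saturated i φ → Γ ⊢ ~ χ (state i)
    unsaturated⇒excluded {i} {φ} φ∈ ¬sat = tautological
      (□-name (∈-⊡⁺ λ j r → truth⁺ φ (successors j r)) ∷ □-cong (name-truth φ-local) ∷ [])
      λ { v (h ∷ k ∷ []) → ~⁺ λ v⊨χ → i⊭□φ
          (⊨-local (atoms θ) (boxed-atom θ φ∈ , φ-local) (χ⁻ v⊨χ) (⇔⁻¹ k (⇒⁻ h v⊨χ))) }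
      where
      φ-local : Local φ
      φ-local = All.lookup boxed-local φ∈

      i⊭□φ : ¬ (state i ⊨ □ φ)
      i⊭□φ h = ¬sat (const h)

      successors : ∀ j → R i j → state j ⊨ φ
      successors j r with state j ⊨? φ
      ... | yes h = h
      ... | no ¬h = contradiction (λ hs → contradiction (hs j r) ¬h) ¬sat

  module Saturation (saturated : ∀ i → All (Saturated i) (boxed θ)) where

    -- Saturation gives the first inclusion; the second is built into `R`.
    ⊡-truth : ∀ {φ} → φ ∈ₗ boxed θ → ⊡ (truth φ) ≡ truth (□ φ)
    ⊡-truth {φ} φ∈ = ⊆-antisym
      (λ i∈ → truth⁺ (□ φ) (All.lookup (saturated _) φ∈ λ j r → truth⁻ φ (∈-⊡⁻ i∈ j r)))
      (λ i∈ → ∈-⊡⁺ λ j r → truth⁺ φ (proj₁ (All.lookup r φ∈ (truth⁻ (□ φ) i∈))))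

    open Valuation algebra (λ x → encode (truth (var x))) public

    -- The truth lemma of the filtration: the Boolean cases are pointwise, and the box case is
    -- `⊡-truth`.
    decode-⟦⟧ : ∀ φ → Local φ → decode ⟦ φ ⟧ ≡ truth φ
    decode-⟦⟧ (var x) _ = decode-encode _
    decode-⟦⟧ ⊥̇ _ = trans (decode-encode _)
      (⊆-antisym (λ i∈ → contradiction i∈ ∉⊥) (λ i∈ → contradiction (truth⁻ ⊥̇ i∈) λ ()))
    decode-⟦⟧ ⊤̇ _ = trans (decode-encode _) (⊆-antisym (λ _ → truth⁺ ⊤̇ ⟨ tt ⟩) (λ _ → ∈⊤))
    decode-⟦⟧ (~ φ) a = trans (decode-encode _) (trans (cong ∁ (decode-⟦⟧ φ a)) (⊆-antisym
      (λ i∈ → truth⁺ (~ φ) (~⁺ (x∈∁p⇒x∉p i∈ ∘ truth⁺ φ)))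
      (λ i∈ → x∉p⇒x∈∁p (~⁻ (truth⁻ (~ φ) i∈) ∘ truth⁻ φ))))
    decode-⟦⟧ (φ ⋀ ψ) (a , b) = trans (decode-encode _) (trans (cong₂ _∩_ (decode-⟦⟧ φ a) (decode-⟦⟧ ψ b)) (⊆-antisym
      (λ i∈ → let i∈φ , i∈ψ = x∈p∩q⁻ (truth φ) (truth ψ) i∈ in truth⁺ (φ ⋀ ψ) (⋀⁺ (truth⁻ φ i∈φ) (truth⁻ ψ i∈ψ)))
      (λ i∈ → let i⊨φ , i⊨ψ = ⋀⁻ (truth⁻ (φ ⋀ ψ) i∈) in x∈p∩q⁺ (truth⁺ φ i⊨φ , truth⁺ ψ i⊨ψ))))
    decode-⟦⟧ (φ ⋁ ψ) (a , b) = trans (decode-encode _) (trans (cong₂ _∪_ (decode-⟦⟧ φ a) (decode-⟦⟧ ψ b)) (⊆-antisym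
      (λ i∈ → truth⁺ (φ ⋁ ψ) (⋁⁺ (Sum.map (truth⁻ φ) (truth⁻ ψ) (x∈p∪q⁻ (truth φ) (truth ψ) i∈))))
      (λ i∈ → x∈p∪q⁺ (Sum.map (truth⁺ φ) (truth⁺ ψ) (⋁⁻ (truth⁻ (φ ⋁ ψ) i∈))))))
    decode-⟦⟧ (φ ⇒ ψ) (a , b) = trans (decode-encode _)
      (trans (cong₂ _∪_ (trans (decode-encode _) (cong ∁ (decode-⟦⟧ φ a))) (decode-⟦⟧ ψ b)) (⊆-antisym
        (λ i∈ → truth⁺ (φ ⇒ ψ) (⇒⁺ λ h → Sum.[ contradiction (truth⁺ φ h) ∘ x∈∁p⇒x∉p , truth⁻ ψ ]
          (x∈p∪q⁻ (∁ (truth φ)) (truth ψ) i∈)))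
        (λ i∈ → x∈p∪q⁺ (implication (truth⁻ (φ ⇒ ψ) i∈)))))
      where
      implication : ∀ {i} → state i ⊨ φ ⇒ ψ → i ∈ ∁ (truth φ) ⊎ i ∈ truth ψ
      implication {i} h with state i ⊨? φ
      ... | yes k = inj₂ (truth⁺ ψ (⇒⁻ h k))
      ... | no ¬k = inj₁ (x∉p⇒x∈∁p (¬k ∘ truth⁻ φ))
    decode-⟦⟧ (□ φ) (i , a) = trans (decode-encode _) (trans (cong ⊡ (decode-⟦⟧ φ a)) (⊡-truth (box-atom θ i)))

    D□? : ∀ a → Dec (Any (λ φ → a ≡ ⟦ φ ⟧) (boxed θ))
    D□? a = Any.any? (λ φ → a ≟ ⟦ φ ⟧) (boxed θ)

    D□ : Subset (2 ℕ.^ m)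
    D□ = comprehension D□?

    open Canonical algebra Subset.⊥ D□ public using (p; premises; conclusions; premises-All; conclusions-All)

    refutation : ∀ {M Γ Δ} → InNExtGLR M → All Local Γ → All Local Δ →
      (∀ i → All (state i ⊨_) Γ) → All (λ δ → ∃ λ i → ¬ (state i ⊨ δ)) Δ →
      M (Γ / Δ) → M (ξ⁺ algebra Subset.⊥ D□)
    refutation M∈NExt Γ-local Δ-local Γ-true Δ-false =
      refuted⇒ξ⁺ Subset.⊥ D□
        (λ φ i → ∈-comprehension⁺ D□? (lose (box-atom θ i) refl))
        M∈NExt Γ-local Δ-local
        (All.tabulate λ {γ} γ∈ → decode-injective (trans (decode-⟦⟧ γ (All.lookup Γ-local γ∈))
          (trans (⊆-antisym (λ _ → ∈⊤) (λ {i} _ → truth⁺ γ (All.lookup (Γ-true i) γ∈))) (sym (decode-encode Subset.⊤)))))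
        (All.zipWith (λ { {δ} (a , i , i⊭δ) eq → i⊭δ (truth⁻ δ (subst (i ∈_) (trans (sym (decode-encode Subset.⊤))
          (trans (cong decode (sym eq)) (decode-⟦⟧ δ a))) ∈⊤)) }) (Δ-local , Δ-false))

    -- Variable number x stands for p_a with toℕ a = x; numbers from 2 ^ m on do not occur in ξ⁺.
    naming-by : ∀ x → Dec (x ℕ.< 2 ℕ.^ m) → Fm
    naming-by x (yes x<) = name (decode (fromℕ< x<))
    naming-by x (no _)   = ⊤̇

    named : ℕ → Fm
    named x = naming-by x (x ℕ.<? 2 ℕ.^ m)

    named-toℕ : ∀ a → named (toℕ a) ≡ name (decode a)
    named-toℕ a with toℕ a ℕ.<? 2 ℕ.^ m
    ... | yes a< = cong (name ∘ decode) (fromℕ<-toℕ a a<)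
    ... | no a≮  = contradiction (toℕ<n a) a≮

    module _ {Γ N : List Fm} (Γ⊢N : All (Γ ⊢_) N)
      (covering : ∀ w → All (w ⊨_) N → ∃ λ i → w ∼ state i) where

      open Theory Γ⊢N covering

      -- The Boolean premises hold state by state, and the stability premises are `□⁺-name`. With
      -- `Subset.⊥` as `D□⁺` no converse of the latter is demanded.
      named-premises : All (Γ ⊢_) (map (_⟪ named ⟫) premises)
      named-premises = All.map⁺ (premises-All ∧-case ∨-case ¬-case □⁺-case (λ a∈⊥ → contradiction a∈⊥ ∉⊥) □-case)
        where
        ∧-case : ∀ a b → Γ ⊢ ((p (a ∧ᴬ b) ⇔ᶠ (p a ⋀ p b)) ⟪ named ⟫)
        ∧-case a b rewrite named-toℕ (a ∧ᴬ b) | named-toℕ a | named-toℕ b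
                         | decode-encode (decode {m} a ∩ decode b) =
          by-states [] λ w i w∼i _ → ⇔⁺
            (λ h → let i∈a , i∈b = x∈p∩q⁻ _ _ (name⁻ w∼i h) in ⋀⁺ (name⁺ w∼i i∈a) (name⁺ w∼i i∈b))
            (λ h → let h₁ , h₂ = ⋀⁻ h in name⁺ w∼i (x∈p∩q⁺ (name⁻ w∼i h₁ , name⁻ w∼i h₂)))

        ∨-case : ∀ a b → Γ ⊢ ((p (a ∨ᴬ b) ⇔ᶠ (p a ⋁ p b)) ⟪ named ⟫)
        ∨-case a b rewrite named-toℕ (a ∨ᴬ b) | named-toℕ a | named-toℕ b
                         | decode-encode (decode {m} a ∪ decode b) =
          by-states [] λ w i w∼i _ → ⇔⁺
            (λ h → ⋁⁺ (Sum.map (name⁺ w∼i) (name⁺ w∼i) (x∈p∪q⁻ _ _ (name⁻ w∼i h))))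
            (λ h → name⁺ w∼i (x∈p∪q⁺ (Sum.map (name⁻ w∼i) (name⁻ w∼i) (⋁⁻ h))))

        ¬-case : ∀ a → Γ ⊢ ((p (¬ᴬ a) ⇔ᶠ (~ p a)) ⟪ named ⟫)
        ¬-case a rewrite named-toℕ (¬ᴬ a) | named-toℕ a | decode-encode (∁ (decode {m} a)) =
          by-states [] λ w i w∼i _ → ⇔⁺
            (λ h → ~⁺ λ k → x∈∁p⇒x∉p (name⁻ w∼i h) (name⁻ w∼i k))
            (λ h → name⁺ w∼i (x∉p⇒x∈∁p λ i∈a → ~⁻ h (name⁺ w∼i i∈a)))

        □⁺-case : ∀ a → Γ ⊢ ((p (□⁺ᴬ a) ⇒ (□⁺ p a)) ⟪ named ⟫)
        □⁺-case a rewrite named-toℕ (□⁺ᴬ a) | named-toℕ a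
                        | decode-encode (decode {m} (□ᴬ a) ∩ decode a) | decode-encode (⊡ (decode a)) =
          □⁺-name (decode a)

        □-case : ∀ {a} → a ∈ D□ → Γ ⊢ ((p (□ᴬ a) ⇔ᶠ (□ p a)) ⟪ named ⟫)
        -- An element of `D□` is the value of some `φ` under a box, and `⊡ (truth φ)` is the truth
        -- set of `□ φ`; so both sides are equivalent to `□ φ`.
        □-case {a} a∈D□ with find (∈-comprehension⁻ D□? a∈D□)
        ... | φ , φ∈ , refl
          rewrite named-toℕ (□ᴬ ⟦ φ ⟧) | named-toℕ ⟦ φ ⟧ | decode-encode (⊡ (decode ⟦ φ ⟧))
                | decode-⟦⟧ φ (All.lookup boxed-local φ∈) | ⊡-truth φ∈ =
          tautological
            ( name-truth (boxed-atom θ φ∈ , All.lookup boxed-local φ∈)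
            ∷ □-cong (name-truth (All.lookup boxed-local φ∈)) ∷ [])
            λ { v (h ∷ k ∷ []) → ⇔⁺ (⇔⁻² k ∘ ⇔⁻¹ h) (⇔⁻² h ∘ ⇔⁻¹ k) }

      -- An element other than 1 omits some state `i`, and its name is then incompatible with the
      -- description of `i`.
      named-conclusions : All (λ δ → ∃ λ i → (δ ∷ Γ) ⊢ ~ χ (state i)) (map (_⟪ named ⟫) conclusions)
      named-conclusions = All.map⁺ (conclusions-All excluded)
        where
        missing : ∀ {a} → a ≢ 1ᴬ → ∃ λ i → ¬ (i ∈ decode a)
        missing {a} a≢1 = ¬∀⟶∃¬ m _ (_∈? decode a) λ h →
          a≢1 (decode-injective (trans (⊆-antisym (λ _ → ∈⊤) (λ {i} _ → h i)) (sym (decode-encode Subset.⊤))))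

        excluded : ∀ {a} → a ≢ 1ᴬ → ∃ λ i → ((p a ⟪ named ⟫) ∷ Γ) ⊢ ~ χ (state i)
        excluded {a} a≢1 rewrite named-toℕ a =
          let i , i∉a = missing a≢1
          in i , tautological (hyp (here refl) ∷ []) λ { v (h ∷ []) → ~⁺ λ v⊨χ → i∉a (name⁻ (χ⁻ v⊨χ) h) }

      ξ⁺⇒excluded : ∀ {M Δ} → InNExtGLR M → M (ξ⁺ algebra Subset.⊥ D□) →
        (∀ i → (~ χ (state i)) ∈ₗ Δ) → M (Γ / Δ)
      ξ⁺⇒excluded M∈NExt ξ∈M excluded∈ = cut*
        (IsModalRuleSystem.structural (proj₁ M∈NExt) named ξ∈M)
        named-premises
        (All.map (λ { (i , t) → sound-∈ t (excluded∈ i) }) named-conclusions)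
        where open RuleSystem M∈NExt

-- Axiomatisation by pre-stable canonical rules

PreStableRules : (Rule → Set) → Rule → Set
PreStableRules M r = M r × Σ _ λ n → Σ (FinModalAlgebra n) λ 𝔄 → IsK4 𝔄 ×
  Σ (Subset n) λ D⁺ → Σ (Subset n) λ D → r ≡ ξ⁺ 𝔄 D⁺ D

module Axiomatisation {M : Rule → Set} (M∈NExt : InNExtGLR M) (Γ Δ : List Fm) (m : M (Γ / Δ)) where

  -- The conjunction collects the atoms and boxed subformulas of the whole rule in a single formula.
  θ : Fm
  θ = ⋀* (Γ ++ Δ)

  open States θ

  N : Rule → Set
  N = GLR⊕ (PreStableRules M)

  open RuleSystem (GLR⊕-inNExt (PreStableRules M))

  ΓΔ-local : All Local (Γ ++ Δ)
  ΓΔ-local = AllAtoms-⋀*⁻ (Γ ++ Δ) (AllAtoms-atoms θ)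

  Γ-local : All Local Γ
  Γ-local = All.++⁻ˡ Γ ΓΔ-local

  Δ-local : All Local Δ
  Δ-local = All.++⁻ʳ Γ ΓΔ-local

  module Partition (out in′ : List Val)
    (exhaustive : ∀ {s} → s ∈ₗ valuations (atoms θ) → s ∈ₗ out ⊎ s ∈ₗ in′) where

    excluded : List Val → List Fm
    excluded = map (~_ ∘ χ)

    Γ′ Δ′ : List Fm
    Γ′ = excluded out ++ Γ
    Δ′ = excluded in′ ++ Δ

    thinned : ∃ λ ts → Distinct (atoms θ) ts × (∀ {s} → s ∈ₗ ts → s ∈ₗ in′) ×
                       (∀ {w} → Any (w ∼_) in′ → Any (w ∼_) ts)
    thinned = thin (atoms θ) in′

    states : List Val
    states = proj₁ thinned

    state : Fin (length states) → Val
    state = lookup states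

    state-excluded∈ : ∀ i → (~ χ (state i)) ∈ₗ Δ′
    state-excluded∈ i = ∈-++⁺ˡ (∈-map⁺ (~_ ∘ χ) (proj₁ (proj₂ (proj₂ thinned)) (∈-lookup i)))

    Γ′⊢excluded : All (Γ′ ⊢_) (excluded out)
    Γ′⊢excluded = All.tabulate (hyp ∘ ∈-++⁺ˡ)

    -- The representative of `w` cannot be in `out`, where its description is denied, so it is in
    -- `in′` and survives thinning up to agreement.
    covering : ∀ w → All (w ⊨_) (excluded out) → ∃ λ i → w ∼ state i
    covering w hs with find (valuations-cover (atoms θ) w)
    ... | s , s∈ , w∼s with exhaustive s∈
    ...   | inj₁ s∈out = contradiction (χ⁺ w∼s) (~⁻ (All.lookup (All.map⁻ hs) s∈out))
    ...   | inj₂ s∈in  = let c = proj₂ (proj₂ (proj₂ thinned)) (lose s∈in w∼s) in Any.index c , Any.lookup-index c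

    open Filtration θ state (distinct-lookup (atoms θ) (proj₁ (proj₂ thinned)))
    open Theory Γ′⊢excluded covering

    -- The exclusion of each possible state is among the conclusions, so proving a single one closes
    -- the branch.
    excluded-state : ∀ {i} → Γ′ ⊢ ~ χ (state i) → N (Γ′ / Δ′)
    excluded-state {i} t = sound-∈ t (state-excluded∈ i)

    derivation : N (Γ′ / Δ′)
    derivation with all? (λ i → All.all? (saturated? i) (boxed θ))
    ... | no ¬saturated =
      let i , h = ¬∀⟶∃¬ _ _ (λ i → All.all? (saturated? i) (boxed θ)) ¬saturated
          φ , φ∈ , ¬sat = find (All.¬All⇒Any¬ (saturated? i) _ h)
      in excluded-state (unsaturated⇒excluded φ∈ ¬sat)
    ... | yes saturated with all? (λ i → All.all? (state i ⊨?_) Γ)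
    ...   | no ¬Γ-true =
      let i , h = ¬∀⟶∃¬ _ _ (λ i → All.all? (state i ⊨?_) Γ) ¬Γ-true
          γ , γ∈ , i⊭γ = find (All.¬All⇒Any¬ (state i ⊨?_) _ h)
      in excluded-state (false⇒excluded (All.lookup Γ-local γ∈) (hyp (∈-++⁺ʳ (excluded out) γ∈)) i⊭γ)
    ...   | yes Γ-true with Any.any? (λ δ → all? (λ i → state i ⊨? δ)) Δ
    ...     | yes Δ-valid =
      let δ , δ∈ , h = find Δ-valid
      in sound-∈ (true⇒theorem (All.lookup Δ-local δ∈) h) (∈-++⁺ʳ (excluded in′) δ∈)
    -- If no state is possible, then `Δ` is empty in this case; the algebra has one element and its
    -- rule has no conclusions.
    ...     | no ¬Δ-valid = ξ⁺⇒excluded Γ′⊢excluded covering (GLR⊕-inNExt (PreStableRules M))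
      (base (inj₂ (ξ∈M , _ , algebra , algebra-K4 R-transitive , Subset.⊥ , D□ , refl)))
      state-excluded∈
      where
      open Saturation saturated
      ξ∈M : M (ξ⁺ algebra Subset.⊥ D□)
      ξ∈M = refutation M∈NExt Γ-local Δ-local Γ-true
        (All.map (¬∀⟶∃¬ _ _ (λ i → state i ⊨? _)) (All.¬Any⇒All¬ Δ ¬Δ-valid)) m

  derivable : N (Γ / Δ)
  derivable = cut-split (~_ ∘ χ) (valuations (atoms θ)) Partition.derivation

theorem5p26 : (M : Rule → Set) → InNExtGLR M →
    Σ (Rule → Set) λ Ξ → OnlyPreStableK4 Ξ × (∀ r → M r ⇔ GLR⊕ Ξ r)
theorem5p26 M M∈NExt = PreStableRules M , (λ _ → proj₂) , λ { r@(Γ / Δ) → mk⇔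
  (Axiomatisation.derivable M∈NExt Γ Δ)
  -- The axioms were chosen among the rules of `M`, so the converse inclusion follows by leastness.
  (derivable-least (proj₁ M∈NExt) (λ { r (inj₁ a) → proj₂ M∈NExt r (base a) ; r (inj₂ (m , _)) → m }) r) }
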